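{- Let $k \ge 1$ be an integer and let $G$ be a connected $k$-SI graph with at least two vertices, of order $n(G)$, size $m(G)$, and maximum degree $\Delta(G)$. Then $$m(G) \le \frac{n(G)\,\Delta(G)\,(\Delta(G)-k)}{2\Delta(G)-k},$$ and equality holds if and only if $C_d(G) = 2$.
   Context: Graphs are finite and simple. For a positive integer $k$, a graph $G$ is a $k$-stepwise irregular graph ($k$-SI graph) if $|d_G(u) - d_G(v)| = k$ for every edge $uv \in E(G)$, where $d_G(x)$ is the degree of $x$ in $G$. The order $n(G)$ is the number of vertices and the size $m(G)$ is the number of edges. The degree complexity $C_d(G)$ is the number of distinct vertex degrees occurring in $G$. -}

module Defs where

open import Data.Fin as Fin using (Fin)
import Data.Fin.Properties as Fin
open import Data.Integer using (+_; +≤+)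
import Data.Integer.Properties as ℤ
open import Data.List using (List; allFin; cartesianProduct; deduplicate; filter; length; map)
open import Data.List.Extrema.Nat using (max; xs≤max)
open import Data.List.Membership.Propositional.Properties using (∈-allFin; ∈-map⁺)
import Data.List.Relation.Unary.All as All
open import Data.Nat as ℕ using (ℕ; suc; s≤s; z≤n; ∣_-_∣)
import Data.Nat.Properties as ℕ
open import Data.Product using (Σ; _×_; _,_)
open import Data.Rational using (ℚ; 0ℚ; 1ℚ; NonZero; Positive; _+_; _*_; -_; _-_; _≤_; *≤*; nonNegative)
import Data.Rational.Properties as ℚ
open import Data.Rational.Literals using (fromℤ)
open import Level using (0ℓ)
open import Relation.Binary.Core using (Rel)
open import Relation.Binary.Definitions using (Decidable; Irreflexive; Symmetric)
open import Relation.Binary.Construct.Closure.ReflexiveTransitive using (Star; ε; _◅_)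
open import Relation.Binary.PropositionalEquality
  using (_≡_; sym; trans; cong; subst)
open import Relation.Nullary.Decidable using (_×-dec_)

record Graph : Set₁ where
  field
    order  : ℕ
    Adj    : Rel (Fin order) 0ℓ
    adj?   : Decidable Adj
    symm   : Symmetric Adj
    irrefl : Irreflexive _≡_ Adj

  Vertex : Set
  Vertex = Fin order

  vertices : List Vertex
  vertices = allFin order

  degree : Vertex → ℕ
  degree v = length (filter (adj? v) vertices)

  -- Each edge is listed once, with its smaller endpoint first.
  edges : List (Vertex × Vertex)
  edges = filter (λ (u , v) → (u Fin.<? v) ×-dec adj? u v)
                 (cartesianProduct vertices vertices)

  size : ℕ
  size = length edges

  degrees : List ℕ
  degrees = map degree vertices

  maxDegree : ℕ
  maxDegree = max 0 degrees

  degreeComplexity : ℕ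
  degreeComplexity = length (deduplicate ℕ._≟_ degrees)

  Connected : Set
  Connected = ∀ u v → Star Adj u v

  StepwiseIrregular : ℕ → Set
  StepwiseIrregular k = ∀ {u v} → Adj u v → ∣ degree u - degree v ∣ ≡ k

open Graph public

fromℕ : ℕ → ℚ
fromℕ n = fromℤ (+ n)

private
  degree≤maxDegree : ∀ G v → degree G v ℕ.≤ maxDegree G
  degree≤maxDegree G v =
    All.lookup (xs≤max 0 (degrees G)) (∈-map⁺ (degree G) (∈-allFin v))

  ∃edge : ∀ G → Connected G → 2 ℕ.≤ order G →
          Σ (Vertex G) λ u → Σ (Vertex G) λ v → Adj G u v
  ∃edge record { order = suc (suc _) } conn _ with conn Fin.zero (Fin.suc Fin.zero)
  ... | e ◅ _ = _ , _ , e
  ∃edge record { order = 1 } _ (s≤s ())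

  k≤maxDegree : ∀ {k} G → Connected G → 2 ℕ.≤ order G →
                StepwiseIrregular G k → k ℕ.≤ maxDegree G
  k≤maxDegree G conn n≥2 si with ∃edge G conn n≥2
  ... | u , v , e = subst (ℕ._≤ maxDegree G) (si e)
    (ℕ.≤-trans (ℕ.∣m-n∣≤m⊔n (degree G u) (degree G v))
               (ℕ.⊔-lub (degree≤maxDegree G u) (degree≤maxDegree G v)))

  fromℕ-mono : ∀ {m n} → m ℕ.≤ n → fromℕ m ≤ fromℕ n
  fromℕ-mono m≤n = *≤* (ℤ.*-monoʳ-≤-nonNeg (+ 1) (+≤+ m≤n))

  2p-q≡p+[p-q] : ∀ p q → fromℕ 2 * p - q ≡ p + (p - q)
  2p-q≡p+[p-q] p q = trans
    (cong (_- q) (trans (ℚ.*-distribʳ-+ p 1ℚ 1ℚ)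
                        (cong (λ r → r + r) (ℚ.*-identityˡ p))))
    (ℚ.+-assoc p p (- q))

  2Δ-k-positive : ∀ {k Δ} → 1 ℕ.≤ k → k ℕ.≤ Δ → Positive (fromℕ 2 * fromℕ Δ - fromℕ k)
  2Δ-k-positive {suc k} {suc Δ} _ k≤Δ =
    subst Positive (sym (2p-q≡p+[p-q] p q))
      (ℚ.pos+nonNeg⇒pos p (p - q) {{nonNegative 0≤p-q}})
    where
    p = fromℕ (suc Δ)
    q = fromℕ (suc k)

    0≤p-q : 0ℚ ≤ p - q
    0≤p-q = subst (_≤ p - q) (ℚ.+-inverseʳ q) (ℚ.+-monoˡ-≤ (- q) (fromℕ-mono k≤Δ))

-- The denominator of the size bound does not vanish, so the division is legitimate.
2Δ-k≢0 : ∀ {k} G → 1 ℕ.≤ k → Connected G → 2 ℕ.≤ order G → StepwiseIrregular G k →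
         NonZero (fromℕ 2 * fromℕ (maxDegree G) - fromℕ k)
2Δ-k≢0 {k} G k≥1 conn n≥2 si =
  ℚ.pos⇒nonZero (fromℕ 2 * fromℕ (maxDegree G) - fromℕ k)
    {{2Δ-k-positive k≥1 (k≤maxDegree G conn n≥2 si)}}

{-# OPTIONS --safe #-}
-- Put a = Δ − k, and orient every edge towards its endpoint of larger degree.  Then m is the
-- sum of the out-degrees and also the sum of the in-degrees, so
--   m (Δ + a) = Σ_v (Δ · out v + a · in v).
-- Every summand is at most Δ a: if d(v) ≤ a, it is at most Δ · d(v); if d(v) > a, then v has no
-- out-arc, since an out-neighbour would have degree d(v) + k > Δ, and the summand is a · d(v).
-- Both cases are tight exactly when every degree is Δ or a.
module Submission where

open import Defs
open import Data.Fin as Fin using (Fin)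
import Data.Fin.Properties as Fin
open import Data.Integer as ℤ using (+_)
import Data.Integer.Properties as ℤ
open import Data.List using ([]; _∷_; _++_; length; filter; tabulate; cartesianProduct; map; deduplicate)
open import Data.List.Extrema.Nat using (xs≤max; argmax-sel)
open import Data.List.Membership.Propositional using (_∈_)
open import Data.List.Membership.Propositional.Properties
  using (∈-allFin; ∈-map⁺; ∈-map⁻; ∈-filter⁺; ∈-length; ∈-deduplicate⁺)
open import Data.List.Properties using (filter-++; length-++; map-tabulate)
open import Data.List.Relation.Unary.All as All using (All; []; _∷_)
import Data.List.Relation.Unary.All.Properties as All
open import Data.List.Relation.Unary.AllPairs using ([]; _∷_)
open import Data.List.Relation.Unary.Any using (here; there)
open import Data.List.Relation.Unary.Unique.Propositional using (Unique)
open import Data.Nat as ℕ using (ℕ; zero; suc; z≤n; s≤s)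
import Data.Nat.Properties as ℕ
open import Data.List.Relation.Unary.Unique.DecPropositional.Properties ℕ._≟_ using (deduplicate-!)
open import Algebra.Properties.Semiring.Sum ℕ.+-*-semiring
  using (sum; sum-syntax; sum-cong-≗; sum-replicate-zero; ∑-comm; ∑-distrib-+; *-distribˡ-sum)
open import Data.Product using (_×_; _,_; proj₁; proj₂; ∃; ∃₂)
open import Data.Rational using (ℚ; _≤_; _+_; _*_; _-_; -_; _÷_; 1/_; 0ℚ; 1ℚ; *≤*; NonZero; Positive; ↥_)
import Data.Rational.Properties as ℚ
open import Data.Rational.Unnormalised as ℚᵘ using (*≡*)
import Data.Rational.Unnormalised.Properties as ℚᵘ
open import Data.Sum as Sum using (_⊎_; inj₁; inj₂; [_,_]′)
open import Function using (_∘_)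
open import Function.Bundles using (_⇔_; mk⇔; Equivalence)
open import Function.Construct.Composition using (_⇔-∘_)
open import Function.Construct.Symmetry using (⇔-sym)
open import Level using (Level)
open import Relation.Binary.Construct.Closure.ReflexiveTransitive using (ε; _◅_)
open import Relation.Binary.Core using (Rel)
open import Relation.Binary.Definitions using (Asymmetric; Decidable; Symmetric; tri<; tri≈; tri>)
open import Relation.Binary.PropositionalEquality
open import Relation.Nullary using (Dec; yes; no; ¬_; contradiction)
open import Relation.Nullary.Decidable using (_×-dec_)
import Relation.Unary as Unary

private
  variable
    ℓ ℓ₁ : Level
    A B C : Set ℓ
    n : ℕ

-- Sums and counting

∑-mono : ∀ {f g : Fin n → ℕ} → (∀ i → f i ℕ.≤ g i) → sum f ℕ.≤ sum g
∑-mono {zero}  f≤g = z≤n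
∑-mono {suc n} f≤g = ℕ.+-mono-≤ (f≤g Fin.zero) (∑-mono (f≤g ∘ Fin.suc))

-- From `b + d ≡ a + c ≤ a + d` cancel `d` to get `b ≤ a`; the other equation then follows by
-- cancellation.
+-mono-≤-tight : ∀ {a b c d} → a ℕ.≤ b → c ℕ.≤ d → a ℕ.+ c ≡ b ℕ.+ d → a ≡ b × c ≡ d
+-mono-≤-tight {a} {b} {c} {d} a≤b c≤d eq = a≡b , ℕ.+-cancelˡ-≡ a c d (trans eq (cong (ℕ._+ d) (sym a≡b)))
  where
  a≡b : a ≡ b
  a≡b = ℕ.≤-antisym a≤b (ℕ.+-cancelʳ-≤ d b a (ℕ.≤-trans (ℕ.≤-reflexive (sym eq)) (ℕ.+-monoʳ-≤ a c≤d)))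

-- Carries the equality case: the total weight meets its bound only if every single weight does.
∑-mono-tight : ∀ {f g : Fin n → ℕ} → (∀ i → f i ℕ.≤ g i) → sum f ≡ sum g → ∀ i → f i ≡ g i
∑-mono-tight {suc n} f≤g eq i with +-mono-≤-tight (f≤g Fin.zero) (∑-mono (f≤g ∘ Fin.suc)) eq | i
... | p , _ | Fin.zero  = p
... | _ , q | Fin.suc j = ∑-mono-tight (f≤g ∘ Fin.suc) q j

∑-const : ∀ n c → ∑[ i < n ] c ≡ n ℕ.* c
∑-const zero    c = refl
∑-const (suc n) c = cong (c ℕ.+_) (∑-const n c)

∑-zero : ∀ {f : Fin n → ℕ} → (∀ i → f i ≡ 0) → sum f ≡ 0
∑-zero {n} f≡0 = trans (sum-cong-≗ f≡0) (sum-replicate-zero n)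

𝟙 : Dec A → ℕ
𝟙 (yes _) = 1
𝟙 (no  _) = 0

𝟙-no : (a? : Dec A) → ¬ A → 𝟙 a? ≡ 0
𝟙-no (yes a) ¬a = contradiction a ¬a
𝟙-no (no _)  _  = refl

𝟙-⊎ : (c? : Dec C) (a? : Dec A) (b? : Dec B) →
      (C → A ⊎ B) → (A → C) → (B → C) → (A → ¬ B) → 𝟙 c? ≡ 𝟙 a? ℕ.+ 𝟙 b?
𝟙-⊎ _       (yes a) (yes b) _ _ _ ⊥ = contradiction b (⊥ a)
𝟙-⊎ (yes _) (yes _) (no _)  _ _ _ _ = refl
𝟙-⊎ (yes _) (no _)  (yes _) _ _ _ _ = refl
𝟙-⊎ (no _)  (no _)  (no _)  _ _ _ _ = refl
𝟙-⊎ (yes c) (no ¬a) (no ¬b) s _ _ _ = contradiction (s c) [ ¬a , ¬b ]′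
𝟙-⊎ (no ¬c) (yes a) _       _ f _ _ = contradiction (f a) ¬c
𝟙-⊎ (no ¬c) _       (yes b) _ _ g _ = contradiction (g b) ¬c

module _ {P : Unary.Pred A ℓ} (P? : Unary.Decidable P) where

  -- Degrees and size are lengths of filtered lists; this makes them sums of indicators. `allFin` is
  -- `tabulate` of the identity, and `f` is arbitrary because the induction shifts it by `Fin.suc`.
  length-filter-tabulate : (f : Fin n → A) →
    length (filter P? (tabulate f)) ≡ ∑[ i < n ] 𝟙 (P? (f i))
  length-filter-tabulate {zero}  f = refl
  length-filter-tabulate {suc n} f with P? (f Fin.zero)
  ... | yes _ = cong suc (length-filter-tabulate (f ∘ Fin.suc))
  ... | no  _ = length-filter-tabulate (f ∘ Fin.suc)

module _ {P : Unary.Pred (A × B) ℓ} (P? : Unary.Decidable P) where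

  length-filter-cartesianProduct : ∀ {m} (f : Fin m → A) (g : Fin n → B) →
    length (filter P? (cartesianProduct (tabulate f) (tabulate g))) ≡
    ∑[ i < m ] ∑[ j < n ] 𝟙 (P? (f i , g j))
  length-filter-cartesianProduct {m = zero}  f g = refl
  length-filter-cartesianProduct {n = n} {m = suc m} f g = begin
    length (filter P? (row ++ rows))                 ≡⟨ cong length (filter-++ P? row rows) ⟩
    length (filter P? row ++ filter P? rows)         ≡⟨ length-++ (filter P? row) ⟩
    length (filter P? row) ℕ.+ length (filter P? rows)
      ≡⟨ cong₂ ℕ._+_ row-sum (length-filter-cartesianProduct (f ∘ Fin.suc) g) ⟩
    ∑[ i < suc m ] ∑[ j < n ] 𝟙 (P? (f i , g j))               ∎
    where
    open ≡-Reasoning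
    row  = map (f Fin.zero ,_) (tabulate g)
    rows = cartesianProduct (tabulate (f ∘ Fin.suc)) (tabulate g)

    row-sum : length (filter P? row) ≡ ∑[ j < n ] 𝟙 (P? (f Fin.zero , g j))
    row-sum = trans (cong (length ∘ filter P?) (map-tabulate g (f Fin.zero ,_)))
                    (length-filter-tabulate P? (λ j → f Fin.zero , g j))

-- Orientations of a symmetric relation

module _ {R : Rel (Fin n) ℓ} (R? : Decidable R) (R-sym : Symmetric R)
         {_≺_ : Rel (Fin n) ℓ₁} (_≺?_ : Decidable _≺_) (≺-asym : Asymmetric _≺_)
         (R⇒≺⊎≻ : ∀ {i j} → R i j → i ≺ j ⊎ j ≺ i) where

  𝟙-orient : ∀ i j → 𝟙 (R? i j) ≡ 𝟙 (i ≺? j ×-dec R? i j) ℕ.+ 𝟙 (j ≺? i ×-dec R? j i)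
  𝟙-orient i j = 𝟙-⊎ (R? i j) (i ≺? j ×-dec R? i j) (j ≺? i ×-dec R? j i)
    (λ r → Sum.map (_, r) (_, R-sym r) (R⇒≺⊎≻ r)) proj₂ (R-sym ∘ proj₂)
    (λ (i≺j , _) (j≺i , _) → ≺-asym i≺j j≺i)

  -- Each related pair is an arc in exactly one direction, and exchanging the sums identifies the
  -- two halves. The left side does not mention `≺`, so all such orientations have the same number
  -- of arcs.
  ∑-orient : ∑[ i < n ] ∑[ j < n ] 𝟙 (R? i j) ≡ 2 ℕ.* ∑[ i < n ] ∑[ j < n ] 𝟙 (i ≺? j ×-dec R? i j)
  ∑-orient = begin
    ∑[ i < n ] ∑[ j < n ] 𝟙 (R? i j)
      ≡⟨ sum-cong-≗ (λ i → trans (sum-cong-≗ (𝟙-orient i)) (∑-distrib-+ (arc i) (λ j → arc j i))) ⟩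
    ∑[ i < n ] (∑[ j < n ] arc i j ℕ.+ ∑[ j < n ] arc j i)
      ≡⟨ ∑-distrib-+ (λ i → ∑[ j < n ] arc i j) (λ i → ∑[ j < n ] arc j i) ⟩
    S ℕ.+ ∑[ i < n ] ∑[ j < n ] arc j i
      ≡⟨ cong (S ℕ.+_) (trans (∑-comm (λ i j → arc j i)) (sym (ℕ.+-identityʳ S))) ⟩
    2 ℕ.* S ∎
    where
    open ≡-Reasoning
    arc : Fin n → Fin n → ℕ
    arc i j = 𝟙 (i ≺? j ×-dec R? i j)
    S = ∑[ i < n ] ∑[ j < n ] arc i j

-- Lists with two distinct elements

module _ {x y : A} where

  length≡2⇒ : ∀ {xs} → x ∈ xs → y ∈ xs → x ≢ y → length xs ≡ 2 → All (λ z → z ≡ x ⊎ z ≡ y) xs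
  length≡2⇒ {_ ∷ _ ∷ []} (here refl)         (here refl)         x≢y _ = contradiction refl x≢y
  length≡2⇒ {_ ∷ _ ∷ []} (here refl)         (there (here refl)) x≢y _ = inj₁ refl ∷ inj₂ refl ∷ []
  length≡2⇒ {_ ∷ _ ∷ []} (there (here refl)) (here refl)         x≢y _ = inj₂ refl ∷ inj₁ refl ∷ []
  length≡2⇒ {_ ∷ _ ∷ []} (there (here refl)) (there (here refl)) x≢y _ = contradiction refl x≢y

  length≡2⇐ : ∀ {xs} → Unique xs → x ∈ xs → y ∈ xs → x ≢ y →
              All (λ z → z ≡ x ⊎ z ≡ y) xs → length xs ≡ 2
  length≡2⇐ {_ ∷ []}        _ (here refl) (here refl) x≢y _ = contradiction refl x≢y
  length≡2⇐ {_ ∷ _ ∷ []}    _ _ _ _ _ = refl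
  length≡2⇐ {_ ∷ _ ∷ _ ∷ _} ((p≢q ∷ p≢r ∷ _) ∷ (q≢r ∷ _) ∷ _) _ _ _ (p ∷ q ∷ r ∷ _) with p | q | r
  -- Pigeonhole: three entries with only two possible values contain a repetition, against
  -- uniqueness.
  ... | inj₁ refl | inj₁ refl | _         = contradiction refl p≢q
  ... | inj₂ refl | inj₂ refl | _         = contradiction refl p≢q
  ... | inj₁ refl | inj₂ refl | inj₁ refl = contradiction refl p≢r
  ... | inj₁ refl | inj₂ refl | inj₂ refl = contradiction refl q≢r
  ... | inj₂ refl | inj₁ refl | inj₂ refl = contradiction refl p≢r
  ... | inj₂ refl | inj₁ refl | inj₁ refl = contradiction refl q≢r

-- Degrees of a graph

module _ (G : Graph) where

  private
    d = degree G

  degree≤maxDegree : ∀ v → d v ℕ.≤ maxDegree G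
  degree≤maxDegree v = All.lookup (xs≤max 0 (degrees G)) (∈-map⁺ d (∈-allFin v))

  maxDegree-attained : Vertex G → ∃ λ v → d v ≡ maxDegree G
  maxDegree-attained v with argmax-sel (λ x → x) 0 (degrees G)
  -- The maximum may be the default `0` of `max 0`. Then every degree vanishes, and the given vertex
  -- attains it.
  ... | inj₁ Δ≡0 = v , trans (ℕ.n≤0⇒n≡0 (subst (d v ℕ.≤_) Δ≡0 (degree≤maxDegree v))) (sym Δ≡0)
  ... | inj₂ Δ∈  with ∈-map⁻ d Δ∈
  ...   | w , _ , Δ≡dw = w , sym Δ≡dw

  neighbour : Connected G → 2 ℕ.≤ order G → ∀ v → ∃ (Adj G v)
  neighbour conn n≥2 v = step (other n≥2 v)
    where
    other : ∀ {n} → 2 ℕ.≤ n → (i : Fin n) → ∃ (i ≢_)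
    other (s≤s (s≤s _)) Fin.zero    = Fin.suc Fin.zero , λ ()
    other (s≤s (s≤s _)) (Fin.suc _) = Fin.zero , λ ()

    step : ∃ (v ≢_) → ∃ (Adj G v)
    -- A path to a different vertex is nonempty, and its first edge leads to a neighbour.
    step (w , v≢w) with conn v w
    ... | ε     = contradiction refl v≢w
    ... | e ◅ _ = _ , e

  adj⇒0<degree : ∀ {u v} → Adj G u v → 0 ℕ.< d u
  adj⇒0<degree {u} {v} e = ∈-length (∈-filter⁺ (adj? G u) (∈-allFin v) e)

  -- Both degrees survive deduplication and the resulting list is duplicate-free, so it has length 2
  -- exactly when it contains nothing else.
  degreeComplexity≡2 : ∀ {u v} → d u ≢ d v →
    degreeComplexity G ≡ 2 ⇔ (∀ w → d w ≡ d u ⊎ d w ≡ d v)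
  degreeComplexity≡2 {u} {v} du≢dv = mk⇔
    (λ C≡2 w → All.lookup (length≡2⇒ (occurs u) (occurs v) du≢dv C≡2) (occurs w))
    (λ all → length≡2⇐ (deduplicate-! (degrees G)) (occurs u) (occurs v) du≢dv
      (All.deduplicate⁺ ℕ._≟_ (All.map⁺ (All.tabulate⁺ all))))
    where
    occurs : ∀ w → d w ∈ deduplicate ℕ._≟_ (degrees G)
    occurs w = ∈-deduplicate⁺ ℕ._≟_ (∈-map⁺ d (∈-allFin w))

-- The orientation towards larger degrees

module _ (G : Graph) (k : ℕ) (k≥1 : 1 ℕ.≤ k) (si : StepwiseIrregular G k) where

  private
    N = order G
    d = degree G

  uphill : ∀ {u v} → Adj G u v → d u ℕ.< d v → d v ≡ d u ℕ.+ k
  uphill {u} {v} e du<dv = begin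
    d v                       ≡⟨ ℕ.m+[n∸m]≡n (ℕ.<⇒≤ du<dv) ⟨
    d u ℕ.+ (d v ℕ.∸ d u)     ≡⟨ cong (d u ℕ.+_) (ℕ.m≤n⇒∣m-n∣≡n∸m (ℕ.<⇒≤ du<dv)) ⟨
    d u ℕ.+ ℕ.∣ d u - d v ∣   ≡⟨ cong (d u ℕ.+_) (si e) ⟩
    d u ℕ.+ k                 ∎
    where open ≡-Reasoning

  degree-comparable : ∀ {u v} → Adj G u v → d u ℕ.< d v ⊎ d v ℕ.< d u
  degree-comparable {u} {v} e with ℕ.<-cmp (d u) (d v)
  ... | tri< du<dv _ _ = inj₁ du<dv
  ... | tri> _ _ dv<du = inj₂ dv<du
  -- Equal degrees along an edge would force `k` to be 0.
  ... | tri≈ _ du≡dv _ = contradiction (subst (1 ℕ.≤_) (trans (sym (si e)) (ℕ.m≡n⇒∣m-n∣≡0 du≡dv)) k≥1) λ ()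

  vertex-comparable : ∀ {u v} → Adj G u v → u Fin.< v ⊎ v Fin.< u
  vertex-comparable {u} {v} e with Fin.<-cmp u v
  ... | tri< u<v _ _ = inj₁ u<v
  ... | tri> _ _ v<u = inj₂ v<u
  ... | tri≈ _ u≡v _ = contradiction e (irrefl G u≡v)

  private
    arc : Vertex G → Vertex G → ℕ
    arc u v = 𝟙 (d u ℕ.<? d v ×-dec adj? G u v)

  outdegree indegree : Vertex G → ℕ
  outdegree u = ∑[ v < N ] arc u v
  indegree  v = ∑[ u < N ] arc u v

  outdegree≡0 : ∀ {u} → (∀ {v} → Adj G u v → ¬ d u ℕ.< d v) → outdegree u ≡ 0
  outdegree≡0 {u} ⊥ = ∑-zero λ v → 𝟙-no (d u ℕ.<? d v ×-dec adj? G u v) λ (lt , e) → ⊥ e lt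

  indegree≡0 : ∀ {v} → (∀ {u} → Adj G v u → ¬ d u ℕ.< d v) → indegree v ≡ 0
  indegree≡0 {v} ⊥ = ∑-zero λ u → 𝟙-no (d u ℕ.<? d v ×-dec adj? G u v) λ (lt , e) → ⊥ (symm G e) lt

  degree≡out+in : ∀ v → d v ≡ outdegree v ℕ.+ indegree v
  degree≡out+in v = begin
    d v                                ≡⟨ length-filter-tabulate (adj? G v) (λ w → w) ⟩
    ∑[ w < N ] 𝟙 (adj? G v w)          ≡⟨ sum-cong-≗ (orient v) ⟩
    ∑[ w < N ] (arc v w ℕ.+ arc w v)   ≡⟨ ∑-distrib-+ (arc v) (λ w → arc w v) ⟩
    outdegree v ℕ.+ indegree v         ∎
    where
    open ≡-Reasoning
    orient = 𝟙-orient (adj? G) (symm G) (λ u v → d u ℕ.<? d v) ℕ.<-asym degree-comparable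

  -- `size` counts edges oriented by vertex index, the out-degrees count them oriented by degree.
  -- Each count doubled is the number of ordered adjacent pairs.
  size≡∑outdegree : size G ≡ ∑[ v < N ] outdegree v
  size≡∑outdegree = ℕ.*-cancelˡ-≡ _ _ 2 (begin
    2 ℕ.* size G
      ≡⟨ cong (2 ℕ.*_) (length-filter-cartesianProduct (λ (u , v) → (u Fin.<? v) ×-dec adj? G u v) (λ u → u) (λ v → v)) ⟩
    2 ℕ.* ∑[ u < N ] ∑[ v < N ] 𝟙 (u Fin.<? v ×-dec adj? G u v)
      ≡⟨ ∑-orient (adj? G) (symm G) Fin._<?_ ℕ.<-asym vertex-comparable ⟨
    ∑[ u < N ] ∑[ v < N ] 𝟙 (adj? G u v)
      ≡⟨ ∑-orient (adj? G) (symm G) (λ u v → d u ℕ.<? d v) ℕ.<-asym degree-comparable ⟩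
    2 ℕ.* ∑[ v < N ] outdegree v ∎)
    where open ≡-Reasoning

  size≡∑indegree : size G ≡ ∑[ v < N ] indegree v
  size≡∑indegree = trans size≡∑outdegree (∑-comm arc)

  -- Vertex weights and the bound Δ · a, with a = Δ - k given by an equation to avoid truncated
  -- subtraction.

  module _ {a : ℕ} (Δ≡a+k : maxDegree G ≡ a ℕ.+ k) (a≥1 : 1 ℕ.≤ a) where

    private
      Δ = maxDegree G

      weight : Vertex G → ℕ
      weight v = Δ ℕ.* outdegree v ℕ.+ a ℕ.* indegree v

      a<Δ : a ℕ.< Δ
      a<Δ = subst (a ℕ.<_) (sym Δ≡a+k) (ℕ.m<m+n a k≥1)

      -- These instances permit cancelling the factors `a` and `Δ` in `weight-tight⇒`.
      instance
        a-nonZero : ℕ.NonZero a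
        a-nonZero = ℕ.>-nonZero a≥1

        Δ-nonZero : ℕ.NonZero Δ
        Δ-nonZero = ℕ.>-nonZero (ℕ.≤-trans a≥1 (ℕ.<⇒≤ a<Δ))

    weight≤Δ*degree : ∀ v → weight v ℕ.≤ Δ ℕ.* d v
    weight≤Δ*degree v = begin
      Δ ℕ.* outdegree v ℕ.+ a ℕ.* indegree v   ≤⟨ ℕ.+-monoʳ-≤ _ (ℕ.*-monoˡ-≤ (indegree v) (ℕ.<⇒≤ a<Δ)) ⟩
      Δ ℕ.* outdegree v ℕ.+ Δ ℕ.* indegree v   ≡⟨ ℕ.*-distribˡ-+ Δ (outdegree v) (indegree v) ⟨
      Δ ℕ.* (outdegree v ℕ.+ indegree v)       ≡⟨ cong (Δ ℕ.*_) (degree≡out+in v) ⟨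
      Δ ℕ.* d v                                ∎
      where open ℕ.≤-Reasoning

    weight-sink : ∀ v → outdegree v ≡ 0 → weight v ≡ a ℕ.* d v
    weight-sink v out≡0 = begin
      Δ ℕ.* outdegree v ℕ.+ a ℕ.* indegree v   ≡⟨ cong (λ o → Δ ℕ.* o ℕ.+ a ℕ.* indegree v) out≡0 ⟩
      Δ ℕ.* 0 ℕ.+ a ℕ.* indegree v             ≡⟨ cong (ℕ._+ a ℕ.* indegree v) (ℕ.*-zeroʳ Δ) ⟩
      a ℕ.* indegree v                         ≡⟨ cong (λ o → a ℕ.* (o ℕ.+ indegree v)) out≡0 ⟨
      a ℕ.* (outdegree v ℕ.+ indegree v)       ≡⟨ cong (a ℕ.*_) (degree≡out+in v) ⟨
      a ℕ.* d v                                ∎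
      where open ≡-Reasoning

    weight-source : ∀ v → indegree v ≡ 0 → weight v ≡ Δ ℕ.* d v
    weight-source v in≡0 = begin
      Δ ℕ.* outdegree v ℕ.+ a ℕ.* indegree v   ≡⟨ cong (λ i → Δ ℕ.* outdegree v ℕ.+ a ℕ.* i) in≡0 ⟩
      Δ ℕ.* outdegree v ℕ.+ a ℕ.* 0            ≡⟨ cong (Δ ℕ.* outdegree v ℕ.+_) (ℕ.*-zeroʳ a) ⟩
      Δ ℕ.* outdegree v ℕ.+ 0                  ≡⟨ ℕ.+-identityʳ _ ⟩
      Δ ℕ.* outdegree v                        ≡⟨ cong (Δ ℕ.*_) (ℕ.+-identityʳ (outdegree v)) ⟨
      Δ ℕ.* (outdegree v ℕ.+ 0)                ≡⟨ cong (λ i → Δ ℕ.* (outdegree v ℕ.+ i)) in≡0 ⟨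
      Δ ℕ.* (outdegree v ℕ.+ indegree v)       ≡⟨ cong (Δ ℕ.*_) (degree≡out+in v) ⟨
      Δ ℕ.* d v                                ∎
      where open ≡-Reasoning

    a<degree⇒sink : ∀ {v} → a ℕ.< d v → outdegree v ≡ 0
    a<degree⇒sink {v} a<dv = outdegree≡0 λ {w} e dv<dw → ℕ.<⇒≱ (ℕ.+-monoˡ-< k a<dv)
      (subst₂ ℕ._≤_ (uphill e dv<dw) Δ≡a+k (degree≤maxDegree G w))

    weight≤Δ*a : ∀ v → weight v ℕ.≤ Δ ℕ.* a
    weight≤Δ*a v with d v ℕ.≤? a
    ... | yes dv≤a = ℕ.≤-trans (weight≤Δ*degree v) (ℕ.*-monoʳ-≤ Δ dv≤a)
    ... | no  dv≰a = begin
      weight v   ≡⟨ weight-sink v (a<degree⇒sink (ℕ.≰⇒> dv≰a)) ⟩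
      a ℕ.* d v  ≤⟨ ℕ.*-monoʳ-≤ a (degree≤maxDegree G v) ⟩
      a ℕ.* Δ    ≡⟨ ℕ.*-comm a Δ ⟩
      Δ ℕ.* a    ∎
      where open ℕ.≤-Reasoning

    -- If `d v ≤ a`, then `Δ * a ≤ Δ * d v` and cancelling `Δ` gives `a ≤ d v`. Otherwise `v` is a
    -- sink, so `a * d v ≡ a * Δ` and `a` cancels.
    weight-tight⇒ : ∀ v → weight v ≡ Δ ℕ.* a → d v ≡ Δ ⊎ d v ≡ a
    weight-tight⇒ v tight with d v ℕ.≤? a
    ... | yes dv≤a = inj₂ (ℕ.≤-antisym dv≤a
      (ℕ.*-cancelˡ-≤ Δ (subst (ℕ._≤ Δ ℕ.* d v) tight (weight≤Δ*degree v))))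
    ... | no  dv≰a = inj₁ (ℕ.*-cancelˡ-≡ (d v) Δ a
      (trans (sym (weight-sink v (a<degree⇒sink (ℕ.≰⇒> dv≰a)))) (trans tight (ℕ.*-comm Δ a))))

    weight-tight⇐ : (∀ v → d v ≡ Δ ⊎ d v ≡ a) → ∀ v → weight v ≡ Δ ℕ.* a
    weight-tight⇐ two v with two v
    ... | inj₁ dv≡Δ = begin
      weight v   ≡⟨ weight-sink v (a<degree⇒sink (subst (a ℕ.<_) (sym dv≡Δ) a<Δ)) ⟩
      a ℕ.* d v  ≡⟨ cong (a ℕ.*_) dv≡Δ ⟩
      a ℕ.* Δ    ≡⟨ ℕ.*-comm a Δ ⟩
      Δ ℕ.* a    ∎
      where open ≡-Reasoning
    -- As only `Δ` and `a` occur and `a < Δ`, a vertex of degree `a` has minimum degree and receives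
    -- no arc.
    ... | inj₂ dv≡a = trans (weight-source v (indegree≡0 λ {u} _ → ℕ.≤⇒≯ (a≤d u))) (cong (Δ ℕ.*_) dv≡a)
      where
      a≤d : ∀ u → d v ℕ.≤ d u
      a≤d u = [ (λ du≡Δ → subst₂ ℕ._≤_ (sym dv≡a) (sym du≡Δ) (ℕ.<⇒≤ a<Δ))
              , (λ du≡a → ℕ.≤-reflexive (trans dv≡a (sym du≡a))) ]′ (two u)

    size*[Δ+a]≡∑weight : size G ℕ.* (Δ ℕ.+ a) ≡ ∑[ v < N ] weight v
    size*[Δ+a]≡∑weight = begin
      size G ℕ.* (Δ ℕ.+ a)
        ≡⟨ ℕ.*-comm (size G) (Δ ℕ.+ a) ⟩
      (Δ ℕ.+ a) ℕ.* size G
        ≡⟨ ℕ.*-distribʳ-+ (size G) Δ a ⟩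
      Δ ℕ.* size G ℕ.+ a ℕ.* size G
        ≡⟨ cong₂ (λ x y → Δ ℕ.* x ℕ.+ a ℕ.* y) size≡∑outdegree size≡∑indegree ⟩
      Δ ℕ.* sum outdegree ℕ.+ a ℕ.* sum indegree
        ≡⟨ cong₂ ℕ._+_ (*-distribˡ-sum Δ outdegree) (*-distribˡ-sum a indegree) ⟩
      ∑[ v < N ] (Δ ℕ.* outdegree v) ℕ.+ ∑[ v < N ] (a ℕ.* indegree v)
        ≡⟨ ∑-distrib-+ (λ v → Δ ℕ.* outdegree v) (λ v → a ℕ.* indegree v) ⟨
      ∑[ v < N ] weight v ∎
      where open ≡-Reasoning

    size*[Δ+a]≤ : size G ℕ.* (Δ ℕ.+ a) ℕ.≤ N ℕ.* (Δ ℕ.* a)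
    size*[Δ+a]≤ = subst₂ ℕ._≤_ (sym size*[Δ+a]≡∑weight) (∑-const N (Δ ℕ.* a)) (∑-mono weight≤Δ*a)

    size*[Δ+a]≡⇔ : size G ℕ.* (Δ ℕ.+ a) ≡ N ℕ.* (Δ ℕ.* a) ⇔ (∀ v → d v ≡ Δ ⊎ d v ≡ a)
    size*[Δ+a]≡⇔ = mk⇔
      (λ eq v → weight-tight⇒ v (∑-mono-tight weight≤Δ*a
        (trans (sym size*[Δ+a]≡∑weight) (trans eq (sym (∑-const N (Δ ℕ.* a))))) v))
      (λ two → trans size*[Δ+a]≡∑weight (trans (sum-cong-≗ (weight-tight⇐ two)) (∑-const N (Δ ℕ.* a))))

  -- A neighbour `w` of a vertex `t` of maximum degree cannot lie higher, so it lies exactly `k`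
  -- lower. Thus Δ - k is itself a degree of the graph.
  maxDegree-edge : Connected G → 2 ℕ.≤ N → ∃₂ λ t w → Adj G t w × d t ≡ maxDegree G × maxDegree G ≡ d w ℕ.+ k
  -- The vertex of index 0 only witnesses that the graph is nonempty.
  maxDegree-edge conn n≥2 with maxDegree-attained G (Fin.fromℕ< (ℕ.≤-trans (s≤s z≤n) n≥2))
  ... | t , dt≡Δ with neighbour G conn n≥2 t
  ...   | w , e with degree-comparable e
  ...     | inj₁ dt<dw = contradiction (subst (ℕ._< d w) dt≡Δ dt<dw) (ℕ.≤⇒≯ (degree≤maxDegree G w))
  ...     | inj₂ dw<dt = t , w , e , dt≡Δ , trans (sym dt≡Δ) (uphill (symm G e) dw<dt)

-- The embedding of ℕ in ℚ

-- In the unnormalised rationals the claim is a cross-multiplication with all denominators 1.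
fromℕ-homo-+ : ∀ m n → fromℕ (m ℕ.+ n) ≡ fromℕ m + fromℕ n
fromℕ-homo-+ m n = ℚ.toℚᵘ-injective (ℚᵘ.≃-trans
  (*≡* (cong (ℤ._* (+ 1)) (sym (cong₂ ℤ._+_ (ℤ.*-identityʳ (+ m)) (ℤ.*-identityʳ (+ n))))))
  (ℚᵘ.≃-sym (ℚ.toℚᵘ-homo-+ (fromℕ m) (fromℕ n))))

fromℕ-homo-* : ∀ m n → fromℕ (m ℕ.* n) ≡ fromℕ m * fromℕ n
fromℕ-homo-* m n = ℚ.toℚᵘ-injective (ℚᵘ.≃-trans
  (*≡* (cong (ℤ._* (+ 1)) (ℤ.pos-* m n)))
  (ℚᵘ.≃-sym (ℚ.toℚᵘ-homo-* (fromℕ m) (fromℕ n))))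

fromℕ-mono-≤ : ∀ {m n} → m ℕ.≤ n → fromℕ m ≤ fromℕ n
fromℕ-mono-≤ m≤n = *≤* (ℤ.*-monoʳ-≤-nonNeg (+ 1) (ℤ.+≤+ m≤n))

fromℕ-injective : ∀ {m n} → fromℕ m ≡ fromℕ n → m ≡ n
fromℕ-injective = ℤ.+-injective ∘ cong ↥_

-- Turns the rational differences Δ - k and 2Δ - k of the bound into images of natural numbers.
m≡n+k⇒fromℕ[m]-fromℕ[k]≡fromℕ[n] : ∀ {m n k} → m ≡ n ℕ.+ k → fromℕ m - fromℕ k ≡ fromℕ n
m≡n+k⇒fromℕ[m]-fromℕ[k]≡fromℕ[n] {n = n} {k} refl = begin
  fromℕ (n ℕ.+ k) - fromℕ k         ≡⟨ cong (_- fromℕ k) (fromℕ-homo-+ n k) ⟩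
  fromℕ n + fromℕ k - fromℕ k       ≡⟨ ℚ.+-assoc (fromℕ n) (fromℕ k) (- fromℕ k) ⟩
  fromℕ n + (fromℕ k - fromℕ k)     ≡⟨ cong (λ r → fromℕ n + r) (ℚ.+-inverseʳ (fromℕ k)) ⟩
  fromℕ n + 0ℚ                      ≡⟨ ℚ.+-identityʳ (fromℕ n) ⟩
  fromℕ n                           ∎
  where open ≡-Reasoning

-- Division of rationals and multiplication by the denominator.

module _ (p q : ℚ) .{{q≢0 : NonZero q}} where

  [p÷q]*q≡p : (p ÷ q) * q ≡ p
  [p÷q]*q≡p = begin
    p * 1/ q * q     ≡⟨ ℚ.*-assoc p (1/ q) q ⟩
    p * (1/ q * q)   ≡⟨ cong (p *_) (ℚ.*-inverseˡ q) ⟩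
    p * 1ℚ           ≡⟨ ℚ.*-identityʳ p ⟩
    p                ∎
    where open ≡-Reasoning

  module _ (r : ℚ) .{{q>0 : Positive q}} where

    r*q≤p⇒r≤p÷q : r * q ≤ p → r ≤ p ÷ q
    r*q≤p⇒r≤p÷q r*q≤p = ℚ.*-cancelʳ-≤-pos q (subst (r * q ≤_) (sym [p÷q]*q≡p) r*q≤p)

    r≡p÷q⇔r*q≡p : r ≡ p ÷ q ⇔ r * q ≡ p
    r≡p÷q⇔r*q≡p = mk⇔
      (λ r≡ → trans (cong (_* q) r≡) [p÷q]*q≡p)
      (λ r*q≡p → ℚ.≤-antisym (r*q≤p⇒r≤p÷q (ℚ.≤-reflexive r*q≡p))
        (ℚ.*-cancelʳ-≤-pos q (ℚ.≤-reflexive (trans [p÷q]*q≡p (sym r*q≡p)))))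

-- The variables p and q only equal fromℕ b and fromℕ e propositionally because NonZero q is
-- given for q as written in the size bound.
fromℕ-÷ : ∀ (m : ℕ) {b e p q} .{{_ : NonZero q}} → p ≡ fromℕ b → q ≡ fromℕ e → 1 ℕ.≤ e → m ℕ.* e ℕ.≤ b →
          fromℕ m ≤ p ÷ q × (fromℕ m ≡ p ÷ q ⇔ m ℕ.* e ≡ b)
-- With `e` exposed as a successor, `Positive (fromℕ e)` is found by instance search.
fromℕ-÷ m {b} {e@(suc _)} refl refl _ me≤b =
  r*q≤p⇒r≤p÷q (fromℕ b) (fromℕ e) (fromℕ m) (subst (_≤ fromℕ b) me (fromℕ-mono-≤ me≤b)) ,
  mk⇔ (λ eq → fromℕ-injective (trans me (Equivalence.to ÷⇔ eq)))
      (λ eq → Equivalence.from ÷⇔ (trans (sym me) (cong fromℕ eq)))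
  where
  me = fromℕ-homo-* m e
  ÷⇔ = r≡p÷q⇔r*q≡p (fromℕ b) (fromℕ e) (fromℕ m)

-- From the inequality in ℕ to the quotient bound in ℚ.

theorem5p1 :
    (k : ℕ) (k≥1 : 1 ℕ.≤ k)
    (G : Graph) (conn : Connected G) (n≥2 : 2 ℕ.≤ order G)
    (si : StepwiseIrregular G k) →
    let n = fromℕ (order G)
        m = fromℕ (size G)
        Δ = fromℕ (maxDegree G)
        κ = fromℕ k
        bound = _÷_ (n * Δ * (Δ - κ)) (fromℕ 2 * Δ - κ) {{2Δ-k≢0 G k≥1 conn n≥2 si}}
    in (m ≤ bound) × ((m ≡ bound) ⇔ (degreeComplexity G ≡ 2))
theorem5p1 k k≥1 G conn n≥2 si with maxDegree-edge G k k≥1 si conn n≥2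
... | t , w , e , dt≡Δ , Δ≡dw+k = proj₁ bounds , C≡2⇔ ⇔-∘ (tight⇔ ⇔-∘ proj₂ bounds)
  where
  N = order G
  Δ = maxDegree G
  -- By `Δ≡dw+k` this is Δ - k; it is positive because `w` is adjacent to `t`.
  a = degree G w

  a≥1 : 1 ℕ.≤ a
  a≥1 = adj⇒0<degree G (symm G e)

  numerator≡ : fromℕ N * fromℕ Δ * (fromℕ Δ - fromℕ k) ≡ fromℕ (N ℕ.* (Δ ℕ.* a))
  numerator≡ = begin
    fromℕ N * fromℕ Δ * (fromℕ Δ - fromℕ k)   ≡⟨ cong (fromℕ N * fromℕ Δ *_) (m≡n+k⇒fromℕ[m]-fromℕ[k]≡fromℕ[n] Δ≡dw+k) ⟩
    fromℕ N * fromℕ Δ * fromℕ a               ≡⟨ ℚ.*-assoc (fromℕ N) (fromℕ Δ) (fromℕ a) ⟩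
    fromℕ N * (fromℕ Δ * fromℕ a)             ≡⟨ cong (fromℕ N *_) (fromℕ-homo-* Δ a) ⟨
    fromℕ N * fromℕ (Δ ℕ.* a)                 ≡⟨ fromℕ-homo-* N (Δ ℕ.* a) ⟨
    fromℕ (N ℕ.* (Δ ℕ.* a))                   ∎
    where open ≡-Reasoning

  denominator≡ : fromℕ 2 * fromℕ Δ - fromℕ k ≡ fromℕ (Δ ℕ.+ a)
  denominator≡ = trans (cong (_- fromℕ k) (sym (fromℕ-homo-* 2 Δ))) (m≡n+k⇒fromℕ[m]-fromℕ[k]≡fromℕ[n] 2Δ≡)
    where
    -- One copy of `Δ` is split as `a + k`, so that 2Δ - k becomes `Δ + a`.
    2Δ≡ : 2 ℕ.* Δ ≡ Δ ℕ.+ a ℕ.+ k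
    2Δ≡ = trans (cong (Δ ℕ.+_) (trans (ℕ.+-identityʳ Δ) Δ≡dw+k)) (sym (ℕ.+-assoc Δ a k))

  bounds = fromℕ-÷ (size G) {{2Δ-k≢0 G k≥1 conn n≥2 si}} numerator≡ denominator≡
    (ℕ.≤-trans a≥1 (ℕ.m≤n+m a Δ)) (size*[Δ+a]≤ G k k≥1 si Δ≡dw+k a≥1)

  tight⇔ = size*[Δ+a]≡⇔ G k k≥1 si Δ≡dw+k a≥1

  dt≢a : degree G t ≢ a
  dt≢a dt≡a = ℕ.<⇒≢ (ℕ.m<m+n a k≥1) (trans (sym dt≡a) (trans dt≡Δ Δ≡dw+k))

  C≡2⇔ : (∀ v → degree G v ≡ Δ ⊎ degree G v ≡ a) ⇔ degreeComplexity G ≡ 2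
  -- The vertices `t` and `w` witness the two distinct degrees; the degree of `t` is then rewritten
  -- to `Δ`.
  C≡2⇔ = subst (λ x → (∀ v → degree G v ≡ x ⊎ degree G v ≡ a) ⇔ degreeComplexity G ≡ 2) dt≡Δ
    (⇔-sym (degreeComplexity≡2 G dt≢a))
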